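{- On each of the following classes of models, the language $\mathcal{L}(\circ)$ is less expressive than the language $\mathcal{L}(\Box)$: the class of all models ($\mathcal{K}$-models), the class of symmetric models ($\mathcal{B}$-models), the class of transitive models ($4$-models), and the class of Euclidean models ($5$-models). That is, for each such class $M$, $\mathcal{L}(\circ)\prec\mathcal{L}(\Box)$ on $M$.
   Context: Let $\mathbf{P}$ be a nonempty set of propositional variables. The language $\mathcal{L}(\circ)$ is given by $\phi::=p\mid\neg\phi\mid(\phi\land\phi)\mid\circ\phi$ and the language $\mathcal{L}(\Box)$ by $\phi::=p\mid\neg\phi\mid(\phi\land\phi)\mid\Box\phi$, with $p\in\mathbf{P}$; other Boolean connectives are the usual abbreviations. A model is $\mathcal{M}=\langle S,R,V\rangle$ with $S$ a nonempty set, $R\subseteq S\times S$, and $V:\mathbf{P}\to\mathcal{P}(S)$. Satisfaction at a pointed model $(\mathcal{M},s)$, $s\in S$: $\mathcal{M},s\vDash p$ iff $s\in V(p)$; Booleans as usual; $\mathcal{M},s\vDash\Box\phi$ iff $\mathcal{M},t\vDash\phi$ for all $t$ with $sRt$; $\mathcal{M},s\vDash\circ\phi$ iff ($\mathcal{M},s\vDash\phi$ implies that $\mathcal{M},t\vDash\phi$ for all $t$ with $sRt$). A model is symmetric / transitive / Euclidean if $R$ is ($R$ is Euclidean if $xRy$ and $xRz$ imply $yRz$). For languages $\mathcal{L}_1,\mathcal{L}_2$ interpreted on the same class $M$ of models: $\mathcal{L}_1\preceq\mathcal{L}_2$ means that for every $\phi\in\mathcal{L}_1$ there is $\psi\in\mathcal{L}_2$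 such that $\mathcal{M},s\vDash\phi$ iff $\mathcal{M},s\vDash\psi$ for all pointed models $(\mathcal{M},s)$ with $\mathcal{M}\in M$. $\mathcal{L}_1$ is less expressive than $\mathcal{L}_2$, written $\mathcal{L}_1\prec\mathcal{L}_2$, if $\mathcal{L}_1\preceq\mathcal{L}_2$ and $\mathcal{L}_2\not\preceq\mathcal{L}_1$. -}

module Defs where

open import Level using (Level; suc; _⊔_)
open import Data.Product using (_×_; ∃-syntax)
open import Data.Unit.Polymorphic using (⊤)
open import Function.Bundles using (_⇔_)
open import Relation.Binary.Core using (Rel)
open import Relation.Binary.Definitions using (Symmetric; Transitive)
open import Relation.Nullary using (¬_)
open import Relation.Unary using (Pred)

infixr 7 _∧′_ _∧″_
infix  8 ¬′_ ¬″_ ∘′_ □″_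

data Form∘ {a} (𝐏 : Set a) : Set a where
  var  : 𝐏 → Form∘ 𝐏
  ¬′_  : Form∘ 𝐏 → Form∘ 𝐏
  _∧′_ : Form∘ 𝐏 → Form∘ 𝐏 → Form∘ 𝐏
  ∘′_  : Form∘ 𝐏 → Form∘ 𝐏

data Form□ {a} (𝐏 : Set a) : Set a where
  var  : 𝐏 → Form□ 𝐏
  ¬″_  : Form□ 𝐏 → Form□ 𝐏
  _∧″_ : Form□ 𝐏 → Form□ 𝐏 → Form□ 𝐏
  □″_  : Form□ 𝐏 → Form□ 𝐏

record Model {a} (𝐏 : Set a) (ℓ : Level) : Set (a ⊔ suc ℓ) where
  field
    S        : Set ℓ
    nonempty : S
    R        : Rel S ℓ
    V        : 𝐏 → Pred S ℓ

module _ {a ℓ : Level} {𝐏 : Set a} where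

  open Model

  infix 4 _,_⊨∘_ _,_⊨□_

  _,_⊨∘_ : (M : Model 𝐏 ℓ) → S M → Form∘ 𝐏 → Set ℓ
  M , s ⊨∘ var p  = V M p s
  M , s ⊨∘ ¬′ φ   = ¬ (M , s ⊨∘ φ)
  M , s ⊨∘ φ ∧′ ψ = (M , s ⊨∘ φ) × (M , s ⊨∘ ψ)
  M , s ⊨∘ ∘′ φ   = M , s ⊨∘ φ → ∀ t → R M s t → M , t ⊨∘ φ

  _,_⊨□_ : (M : Model 𝐏 ℓ) → S M → Form□ 𝐏 → Set ℓ
  M , s ⊨□ var p  = V M p s
  M , s ⊨□ ¬″ φ   = ¬ (M , s ⊨□ φ)
  M , s ⊨□ φ ∧″ ψ = (M , s ⊨□ φ) × (M , s ⊨□ ψ)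
  M , s ⊨□ □″ φ   = ∀ t → R M s t → M , t ⊨□ φ

Euclidean : ∀ {a ℓ} {A : Set a} → Rel A ℓ → Set (a ⊔ ℓ)
Euclidean _∼_ = ∀ {x y z} → x ∼ y → x ∼ z → y ∼ z

-- A language together with its interpretation on pointed models.
record Language {a} (𝐏 : Set a) (ℓ : Level) : Set (suc (a ⊔ ℓ)) where
  field
    Formula : Set a
    Sat     : (M : Model 𝐏 ℓ) → Model.S M → Formula → Set ℓ

𝓛∘ : ∀ {a} (𝐏 : Set a) ℓ → Language 𝐏 ℓ
𝓛∘ 𝐏 ℓ = record { Formula = Form∘ 𝐏 ; Sat = _,_⊨∘_ }

𝓛□ : ∀ {a} (𝐏 : Set a) ℓ → Language 𝐏 ℓ
𝓛□ 𝐏 ℓ = record { Formula = Form□ 𝐏 ; Sat = _,_⊨□_ }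

module _ {a ℓ : Level} {𝐏 : Set a} where

  ModelClass : Set (a ⊔ suc ℓ)
  ModelClass = Pred (Model 𝐏 ℓ) ℓ

  𝒦-models ℬ-models 4-models 5-models : ModelClass
  𝒦-models M = ⊤
  ℬ-models M = Symmetric (Model.R M)
  4-models M = Transitive (Model.R M)
  5-models M = Euclidean (Model.R M)

  infix 4 _⪯_on_ _≺_on_

  _⪯_on_ : Language 𝐏 ℓ → Language 𝐏 ℓ → ModelClass → Set (a ⊔ suc ℓ)
  L₁ ⪯ L₂ on C =
    ∀ (φ : Formula L₁) → ∃[ ψ ] (∀ M → C M → ∀ s → Sat L₁ M s φ ⇔ Sat L₂ M s ψ)
    where open Language

  _≺_on_ : Language 𝐏 ℓ → Language 𝐏 ℓ → ModelClass → Set (a ⊔ suc ℓ)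
  L₁ ≺ L₂ on C = (L₁ ⪯ L₂ on C) × ¬ (L₂ ⪯ L₁ on C)

{-# OPTIONS --safe #-}

-- ∘φ amounts to φ → □φ, so 𝓛(∘) translates into 𝓛(□). Conversely, ∘φ holds
-- wherever a point sees at most itself, so 𝓛(∘) cannot tell a single reflexive
-- point from a single dead end, whereas 𝓛(□) can. Both one-point frames are
-- symmetric, transitive and Euclidean.
module Submission where

open import Axiom.DoubleNegationElimination using (em⇒dne)
open import Axiom.ExcludedMiddle using (ExcludedMiddle)
open import Data.Empty.Polymorphic using (⊥)
open import Data.Product using (_×_; _,_)
open import Data.Product.Function.NonDependent.Propositional using (_×-⇔_)
open import Data.Unit.Polymorphic using (⊤; tt)
open import Function.Bundles using (_⇔_; mk⇔; Equivalence)
open import Function.Construct.Identity using (⇔-id)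
open import Function.Related.TypeIsomorphisms using (¬-cong-⇔)
open import Level using (Level)
open import Relation.Binary.Core using (Rel)
open import Relation.Nullary using (¬_)
open import Defs

open Equivalence using (to; from)

module _ {a : Level} {𝐏 : Set a} where

  ∘⇒□ : Form∘ 𝐏 → Form□ 𝐏
  ∘⇒□ (var p)  = var p
  ∘⇒□ (¬′ φ)   = ¬″ ∘⇒□ φ
  ∘⇒□ (φ ∧′ ψ) = ∘⇒□ φ ∧″ ∘⇒□ ψ
  -- The implication `φ → □φ`, spelled with the primitive negation and conjunction.
  ∘⇒□ (∘′ φ)   = ¬″ (∘⇒□ φ ∧″ ¬″ □″ ∘⇒□ φ)

  ∘⇒□-correct : ∀ {ℓ} → ExcludedMiddle ℓ → (M : Model 𝐏 ℓ) → ∀ φ s →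
    (M , s ⊨∘ φ) ⇔ (M , s ⊨□ ∘⇒□ φ)
  ∘⇒□-correct em M (var p)  s = ⇔-id _
  ∘⇒□-correct em M (¬′ φ)   s = ¬-cong-⇔ (∘⇒□-correct em M φ s)
  ∘⇒□-correct em M (φ ∧′ ψ) s = ∘⇒□-correct em M φ s ×-⇔ ∘⇒□-correct em M ψ s
  ∘⇒□-correct em M (∘′ φ)   s = mk⇔
    (λ ∘φ (φs , ¬□φ) → ¬□φ λ t sRt → to (IH t) (∘φ (from (IH s) φs) t sRt))
    (λ ¬[φ∧¬□φ] φs t sRt → from (IH t)
      -- The negated conjunction yields only the double negation of `□φ`; excluded middle removes
      -- it.
      (em⇒dne em (λ ¬□φ → ¬[φ∧¬□φ] (to (IH s) φs , ¬□φ)) t sRt))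
    where IH = ∘⇒□-correct em M φ

  𝓛∘⪯𝓛□ : ∀ {ℓ} → ExcludedMiddle ℓ → (C : ModelClass) → 𝓛∘ 𝐏 ℓ ⪯ 𝓛□ 𝐏 ℓ on C
  𝓛∘⪯𝓛□ em C φ = ∘⇒□ φ , λ M _ → ∘⇒□-correct em M φ

  onePoint : ∀ {ℓ} → Rel {ℓ} ⊤ ℓ → Model 𝐏 ℓ
  onePoint R = record { S = ⊤ ; nonempty = tt ; R = R ; V = λ _ _ → ⊤ }

  deadEnd loop : ∀ {ℓ} → Model 𝐏 ℓ
  deadEnd = onePoint λ _ _ → ⊥
  loop    = onePoint λ _ _ → ⊤

  -- The only possible successor of `tt` is `tt` itself, so `∘′ φ` is true under any relation; the
  -- other cases never consult it.
  onePoint-∘-equivalent : ∀ {ℓ} (R R′ : Rel {ℓ} ⊤ ℓ) φ →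
    (onePoint R , tt ⊨∘ φ) ⇔ (onePoint R′ , tt ⊨∘ φ)
  onePoint-∘-equivalent R R′ (var p)  = ⇔-id _
  onePoint-∘-equivalent R R′ (¬′ φ)   = ¬-cong-⇔ (onePoint-∘-equivalent R R′ φ)
  onePoint-∘-equivalent R R′ (φ ∧′ ψ) =
    onePoint-∘-equivalent R R′ φ ×-⇔ onePoint-∘-equivalent R R′ ψ
  onePoint-∘-equivalent R R′ (∘′ φ)   = mk⇔ (λ _ φs _ _ → φs) (λ _ φs _ _ → φs)

  𝓛□⋠𝓛∘ : ∀ {ℓ} → 𝐏 → (C : ModelClass) → C deadEnd → C loop →
    ¬ (𝓛□ 𝐏 ℓ ⪯ 𝓛∘ 𝐏 ℓ on C)
  -- The formula `□¬p` separates the two models: it is vacuous at the dead end and fails at the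
  -- loop, where `p` is true at the point's own successor.
  𝓛□⋠𝓛∘ p C deadEnd∈C loop∈C □⪯∘ with □⪯∘ (□″ ¬″ var p)
  ... | ψ , □¬p⇔ψ = loop⊨□¬p tt tt tt
    where
    deadEnd⊨ψ : deadEnd , tt ⊨∘ ψ
    deadEnd⊨ψ = to (□¬p⇔ψ deadEnd deadEnd∈C tt) λ _ ()

    loop⊨□¬p : loop , tt ⊨□ □″ ¬″ var p
    loop⊨□¬p = from (□¬p⇔ψ loop loop∈C tt)
      (to (onePoint-∘-equivalent _ _ ψ) deadEnd⊨ψ)

  𝓛∘≺𝓛□ : ∀ {ℓ} → ExcludedMiddle ℓ → 𝐏 → (C : ModelClass) →
    C deadEnd → C loop → 𝓛∘ 𝐏 ℓ ≺ 𝓛□ 𝐏 ℓ on C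
  𝓛∘≺𝓛□ em p C deadEnd∈C loop∈C = 𝓛∘⪯𝓛□ em C , 𝓛□⋠𝓛∘ p C deadEnd∈C loop∈C

proposition6 : ∀ {a ℓ} → ExcludedMiddle ℓ → (𝐏 : Set a) → 𝐏 →
    (𝓛∘ 𝐏 ℓ ≺ 𝓛□ 𝐏 ℓ on 𝒦-models) ×
    (𝓛∘ 𝐏 ℓ ≺ 𝓛□ 𝐏 ℓ on ℬ-models) ×
    (𝓛∘ 𝐏 ℓ ≺ 𝓛□ 𝐏 ℓ on 4-models) ×
    (𝓛∘ 𝐏 ℓ ≺ 𝓛□ 𝐏 ℓ on 5-models)
proposition6 em 𝐏 p =
  𝓛∘≺𝓛□ em p 𝒦-models tt tt ,
  -- The frame conditions hold vacuously for the empty relation and trivially for the total one.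
  𝓛∘≺𝓛□ em p ℬ-models (λ ()) (λ _ → tt) ,
  𝓛∘≺𝓛□ em p 4-models (λ ()) (λ _ _ → tt) ,
  𝓛∘≺𝓛□ em p 5-models (λ ()) (λ _ _ → tt)
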